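{- For every positive integer $k$, as formal power series in $q$, $$\sum_{n\ge1}\mathrm{spt}k_{do}(n)\,q^n=V_k(q)\,(-q^2;q^2)_\infty+W_k(q)\,(-q;q^2)_\infty+2(-q)^k(q^2;q^2)_{k-1},$$ where $V_1(q)=2q$, $V_k(q)=(q^{2k-1}-q)V_{k-1}(q)+2q^k$ for $k>1$, and $W_1(q)=q$, $W_k(q)=(q^{2k-1}-q)W_{k-1}(q)+q^{2k-1}$ for $k>1$.
   Context: For a partition $\pi$, $s(\pi)$ is its smallest part. $\mathrm{Spt}k_{do}(n)$ is the set of partitions $\pi$ of $n$ in which $s(\pi)$ occurs exactly $k$ times and the remaining parts (those larger than $s(\pi)$) are pairwise distinct and each has parity different from that of $s(\pi)$; $\mathrm{spt}k_{do}(n)=|\mathrm{Spt}k_{do}(n)|$. Notation: $(a;q)_0=1$, $(a;q)_n=\prod_{j=0}^{n-1}(1-aq^j)$, $(a;q)_\infty=\prod_{j\ge0}(1-aq^j)$. -}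

module Defs where

open import Data.Fin.Base using (toℕ)
open import Data.Integer.Base as ℤ using (ℤ; +_; 0ℤ; 1ℤ)
import Data.Integer.Properties as ℤ
open import Data.List.Base using (List; []; _∷_; _++_; map; filter; length)
open import Data.List.Extrema.Nat using (min)
open import Data.List.Membership.Propositional using (_∈_)
open import Data.List.Membership.Propositional.Properties using (∈-map⁺; ∈-map⁻; ∈-++⁺ˡ; ∈-++⁺ʳ; ∈-filter⁺; ∈-filter⁻)
open import Data.List.Relation.Binary.Disjoint.Propositional using (Disjoint)
open import Data.List.Relation.Unary.All as All using (All; []; _∷_)
import Data.List.Relation.Unary.All.Properties as All
open import Data.List.Relation.Unary.AllPairs using ([]; _∷_)
open import Data.List.Relation.Unary.Any using (here)
open import Data.List.Relation.Unary.Linked using (Linked; linked?)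
open import Data.List.Relation.Unary.Unique.Propositional using (Unique)
import Data.List.Relation.Unary.Unique.Propositional.Properties as Unique
open import Data.Nat.Base using (ℕ; zero; suc; _+_; _*_; _∸_; _≤_; _<_; _≥_; z≤n; s≤s; parity; _≤′_; ≤′-refl; ≤′-step)
open import Data.Nat.Properties as ℕ using (_≟_; _≤?_; _<?_; _≥?_)
open import Data.Nat.ListAction using (sum)
import Data.Parity.Properties as ℙ
open import Data.Product.Base using (_×_; _,_; proj₁; proj₂)
open import Function.Bundles using (_⇔_; mk⇔)
open import Relation.Binary.PropositionalEquality using (_≡_; _≢_; refl; sym; trans; cong; cong₂)
open import Relation.Nullary using (Dec; yes; no; ¬?)
open import Relation.Nullary.Decidable using (map′; _×-dec_)
open import Data.List.Relation.Unary.Unique.DecPropositional _≟_ using (unique?)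

open import Algebra.Properties.CommutativeMonoid.Sum ℤ.+-0-commutativeMonoid
  using (sum-cong-≗; sum-replicate-zero; sum⁺-syntax)

record IsPartition (n : ℕ) (π : List ℕ) : Set where
  constructor isPartition
  field
    nonincreasing : Linked _≥_ π
    positive      : All (1 ≤_) π
    sums          : sum π ≡ n

-- The empty partition has no smallest part; the value 0 is a dummy.
smallest : List ℕ → ℕ
smallest []       = 0
smallest (x ∷ xs) = min x xs

occurrences : ℕ → List ℕ → ℕ
occurrences s π = length (filter (s ≟_) π)

remaining : List ℕ → List ℕ
remaining π = filter (smallest π <?_) π

record Sptdo (k n : ℕ) (π : List ℕ) : Set where
  constructor sptdoPartition
  field
    partition      : IsPartition n π
    multiplicity   : occurrences (smallest π) π ≡ k
    distinct       : Unique (remaining π)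
    oppositeParity : All (λ p → parity p ≢ parity (smallest π)) (remaining π)

isPartition? : ∀ n π → Dec (IsPartition n π)
isPartition? n π = map′
  (λ (a , b , c) → isPartition a b c) (λ (isPartition a b c) → a , b , c)
  (linked? _≥?_ π ×-dec All.all? (1 ≤?_) π ×-dec sum π ≟ n)

sptdo? : ∀ k n π → Dec (Sptdo k n π)
sptdo? k n π = map′
  (λ (a , b , c , d) → sptdoPartition a b c d) (λ (sptdoPartition a b c d) → a , b , c , d)
  (isPartition? n π ×-dec occurrences (smallest π) π ≟ k ×-dec unique? (remaining π)
    ×-dec All.all? (λ p → ¬? (parity p ℙ.≟ parity (smallest π))) (remaining π))

incrementHead : List ℕ → List ℕ
incrementHead []       = []
incrementHead (x ∷ xs) = suc x ∷ xs

-- All finite sequences of positive integers with sum n: either the first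
-- entry is 1, or it is one more than that of a composition of n - 1.
compositions : ℕ → List (List ℕ)
compositions 0             = [] ∷ []
compositions 1             = (1 ∷ []) ∷ []
compositions (suc (suc n)) =
  map (1 ∷_) (compositions (suc n)) ++ map incrementHead (compositions (suc n))

Sptdo-list : ℕ → ℕ → List (List ℕ)
Sptdo-list k n = filter (sptdo? k n) (compositions n)

-- The cardinality of the set Sptdo k n, justified by Sptdo-list-unique and
-- ∈-Sptdo-list below.
sptdo : ℕ → ℕ → ℕ
sptdo k n = length (Sptdo-list k n)

incrementHead-injective : ∀ {xs ys} → incrementHead xs ≡ incrementHead ys → xs ≡ ys
incrementHead-injective {[]}    {[]}    refl = refl
incrementHead-injective {_ ∷ _} {_ ∷ _} refl = refl

compositions-positive : ∀ n → All (All (1 ≤_)) (compositions n)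
compositions-positive 0             = [] ∷ []
compositions-positive 1             = (s≤s z≤n ∷ []) ∷ []
compositions-positive (suc (suc n)) = All.++⁺
  (All.map⁺ (All.map (s≤s z≤n ∷_) (compositions-positive (suc n))))
  (All.map⁺ (All.map positive (compositions-positive (suc n))))
  where
  positive : ∀ {xs} → All (1 ≤_) xs → All (1 ≤_) (incrementHead xs)
  positive []       = []
  positive (_ ∷ ps) = s≤s z≤n ∷ ps

compositions-unique : ∀ n → Unique (compositions n)
compositions-unique 0             = [] ∷ []
compositions-unique 1             = [] ∷ []
compositions-unique (suc (suc n)) = Unique.++⁺
  (Unique.map⁺ (λ where refl → refl) (compositions-unique (suc n)))
  (Unique.map⁺ incrementHead-injective (compositions-unique (suc n)))
  disjoint
  where
  differ : ∀ {xs ys} → All (1 ≤_) ys → 1 ∷ xs ≢ incrementHead ys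
  differ (() ∷ _) refl
  disjoint : Disjoint (map (1 ∷_) (compositions (suc n)))
                      (map incrementHead (compositions (suc n)))
  disjoint (l , r) with ∈-map⁻ (1 ∷_) l | ∈-map⁻ incrementHead r
  ... | _ , _ , refl | _ , ys∈ , eq =
    differ (All.lookup (compositions-positive (suc n)) ys∈) eq

compositions-complete : ∀ n {xs} → All (1 ≤_) xs → sum xs ≡ n → xs ∈ compositions n
compositions-complete 0 {[]} _ _ = here refl
compositions-complete 0 {suc _ ∷ _} _ ()
compositions-complete 0 {zero ∷ _} (() ∷ _) _
compositions-complete 1 {zero ∷ _} (() ∷ _) _
compositions-complete 1 {suc zero ∷ []} _ _ = here refl
compositions-complete 1 {suc zero ∷ suc _ ∷ _} _ ()
compositions-complete 1 {suc zero ∷ zero ∷ _} (_ ∷ () ∷ _) _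
compositions-complete (suc (suc n)) {suc zero ∷ xs} (_ ∷ ps) eq =
  ∈-++⁺ˡ (∈-map⁺ (1 ∷_) (compositions-complete (suc n) ps (ℕ.suc-injective eq)))
compositions-complete (suc (suc n)) {suc (suc x) ∷ xs} (_ ∷ ps) eq =
  ∈-++⁺ʳ (map (1 ∷_) (compositions (suc n)))
    (∈-map⁺ incrementHead
      (compositions-complete (suc n) {suc x ∷ xs} (s≤s z≤n ∷ ps) (ℕ.suc-injective eq)))

Sptdo-list-unique : ∀ k n → Unique (Sptdo-list k n)
Sptdo-list-unique k n = Unique.filter⁺ (sptdo? k n) (compositions-unique n)

∈-Sptdo-list : ∀ k n π → π ∈ Sptdo-list k n ⇔ Sptdo k n π
∈-Sptdo-list k n π = mk⇔
  (λ π∈ → proj₂ (∈-filter⁻ (sptdo? k n) {xs = compositions n} π∈))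
  (λ p → let open IsPartition (Sptdo.partition p) in
    ∈-filter⁺ (sptdo? k n) (compositions-complete n positive sums) p)

-- Formal power series over ℤ: f n is the coefficient of q^n.

Series : Set
Series = ℕ → ℤ

infix  4 _≈_
infixl 6 _⊕_ _⊖_
infixl 7 _⊛_
infix  8 ⊝_
infixr 9 _^_

_≈_ : Series → Series → Set
f ≈ g = ∀ n → f n ≡ g n

const : ℤ → Series
const c zero    = c
const c (suc _) = 0ℤ

q : Series
q 1 = 1ℤ
q _ = 0ℤ

_⊕_ _⊖_ _⊛_ : Series → Series → Series
(f ⊕ g) n = f n ℤ.+ g n
(f ⊖ g) n = f n ℤ.- g n
(f ⊛ g) n = ∑[ i ≤ n ] (f (toℕ i) ℤ.* g (n ∸ toℕ i))

⊝_ : Series → Series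
(⊝ f) n = ℤ.- f n

_^_ : Series → ℕ → Series
f ^ zero  = const 1ℤ
f ^ suc n = f ^ n ⊛ f

-- poch a b n = (a; b)_n
poch : Series → Series → ℕ → Series
poch a b zero    = const 1ℤ
poch a b (suc n) = poch a b n ⊛ (const 1ℤ ⊖ a ⊛ b ^ n)

-- poch∞ a b = (a; b)_∞ for b with zero constant term.  The factor 1 - a b^j
-- is then 1 modulo b^j, so the coefficient of q^n is already that of
-- (a; b)_{n+1}; see poch∞-limit.
poch∞ : Series → Series → Series
poch∞ a b n = poch a b (suc n) n

⊛-cong-≤ : ∀ f {g h} n → (∀ i → i ≤ n → g i ≡ h i) → (f ⊛ g) n ≡ (f ⊛ h) n
⊛-cong-≤ f n g≡h = sum-cong-≗ {suc n} λ i →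
  cong (f (toℕ i) ℤ.*_) (g≡h (n ∸ toℕ i) (ℕ.m∸n≤m n (toℕ i)))

⊛-zeroʳ : ∀ f n → (f ⊛ λ _ → 0ℤ) n ≡ 0ℤ
⊛-zeroʳ f n = trans (sum-cong-≗ {suc n} λ i → ℤ.*-zeroʳ (f (toℕ i)))
                    (sum-replicate-zero (suc n))

⊛-identityʳ : ∀ f → f ⊛ const 1ℤ ≈ f
⊛-identityʳ f zero    = trans (ℤ.+-identityʳ _) (ℤ.*-identityʳ (f 0))
⊛-identityʳ f (suc n) =
  trans (cong₂ ℤ._+_ (ℤ.*-zeroʳ (f 0)) (⊛-identityʳ (λ i → f (suc i)) n))
        (ℤ.+-identityˡ _)

^-order : ∀ {b} → b 0 ≡ 0ℤ → ∀ j i → i < j → (b ^ j) i ≡ 0ℤ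
^-order {b} b₀ (suc j) i (s≤s i≤j) =
  trans (sum-cong-≗ {suc i} λ x → term (toℕ x)) (sum-replicate-zero (suc i))
  where
  term : ∀ x → (b ^ j) x ℤ.* b (i ∸ x) ≡ 0ℤ
  term x with x <? j
  ... | yes x<j = trans (cong (ℤ._* b (i ∸ x)) (^-order b₀ j x x<j)) (ℤ.*-zeroˡ (b (i ∸ x)))
  ... | no  x≮j = trans (cong ((b ^ j) x ℤ.*_) (trans (cong b i∸x≡0) b₀)) (ℤ.*-zeroʳ ((b ^ j) x))
    where
    i∸x≡0 : i ∸ x ≡ 0
    i∸x≡0 = ℕ.m≤n⇒m∸n≡0 (ℕ.≤-trans i≤j (ℕ.≮⇒≥ x≮j))

poch-stable : ∀ a {b} → b 0 ≡ 0ℤ → ∀ n m → n < m → poch a b (suc m) n ≡ poch a b m n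
poch-stable a {b} b₀ n m n<m =
  trans (⊛-cong-≤ (poch a b m) n factor) (⊛-identityʳ (poch a b m) n)
  where
  factor : ∀ i → i ≤ n → (const 1ℤ ⊖ a ⊛ b ^ m) i ≡ const 1ℤ i
  factor i i≤n = trans
    (cong (λ z → const 1ℤ i ℤ.- z)
      (trans (⊛-cong-≤ a i λ l l≤i →
                ^-order b₀ m l (ℕ.≤-<-trans l≤i (ℕ.≤-<-trans i≤n n<m)))
             (⊛-zeroʳ a i)))
    (ℤ.+-identityʳ (const 1ℤ i))

poch∞-limit : ∀ a b → b 0 ≡ 0ℤ → ∀ n m → n < m → poch a b m n ≡ poch∞ a b n
poch∞-limit a b b₀ n m n<m = go (ℕ.≤⇒≤′ n<m)
  where
  go : ∀ {m} → suc n ≤′ m → poch a b m n ≡ poch∞ a b n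
  go ≤′-refl       = refl
  go (≤′-step {m} p) = trans (poch-stable a b₀ n m (ℕ.≤′⇒≤ p)) (go p)

sptdoSeries : ℕ → Series
sptdoSeries k zero    = 0ℤ
sptdoSeries k (suc n) = + sptdo k (suc n)

-- V_k and W_k are defined for k ≥ 1 only; the values at 0 are dummies.
V : ℕ → Series
V 0 = const 0ℤ
V 1 = const (+ 2) ⊛ q
V k@(suc k-1@(suc _)) = (q ^ (2 * k ∸ 1) ⊖ q) ⊛ V k-1 ⊕ const (+ 2) ⊛ q ^ k

W : ℕ → Series
W 0 = const 0ℤ
W 1 = q
W k@(suc k-1@(suc _)) = (q ^ (2 * k ∸ 1) ⊖ q) ⊛ W k-1 ⊕ q ^ (2 * k ∸ 1)

{-# OPTIONS --safe #-}

-- Sorting the partitions by their smallest part s, the generating function is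
-- F_k = Σ_{s≥1} q^{ks} P_s with P_s = (-q^{s+1}; q²)_∞.  Inserting
-- P_s = (1 + q^{s+1}) P_{s+2} gives
--   F_{k+1} = (q^{2k+1} - q) F_k + 2 q^{k+1} P_1 + q^{2k+1} P_0,
-- which is also the recurrence satisfied by the right-hand side.  F_0 diverges,
-- but the partial sums obey the same recurrence for k = 0, where the sum
-- telescopes up to a term tending to 2q; this evaluates F_1.
module Submission where

open import Defs
open import Algebra.Bundles using (CommutativeRing)
import Algebra.Solver.Ring
open import Algebra.Solver.Ring.AlmostCommutativeRing using (fromCommutativeRing; _-Raw-AlmostCommutative⟶_; Induced-equivalence)
open import Data.Integer.Base as ℤ using (ℤ; +_; 0ℤ; 1ℤ)
import Data.Integer.Properties as ℤ
import Data.Integer.Tactic.RingSolver as ℤ-Solver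
open import Data.List.Base using (List; []; _∷_; _++_; map; filter; length; replicate)
open import Data.List.Extrema.Nat using (v≤min⁺; min≤⊤; min≤xs)
open import Data.List.Membership.Propositional using (_∈_)
open import Data.List.Membership.Propositional.Properties using (∈-map⁺; ∈-map⁻; ∈-++⁺ˡ; ∈-++⁺ʳ; ∈-++⁻)
open import Data.List.Membership.Propositional.Properties.WithK using (unique∧set⇒bag)
open import Data.List.Properties
  using (length-map; length-++; length-replicate; filter-++; filter-all; filter-none; filter-accept; filter-reject;
         ++-cancelʳ; ++-identityʳ; ∷-injectiveʳ)
open import Data.List.Relation.Binary.BagAndSetEquality using (∼bag⇒↭)
open import Data.List.Relation.Binary.Disjoint.Propositional using (Disjoint)
open import Data.List.Relation.Binary.Permutation.Propositional.Properties using (↭-length)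
open import Data.List.Relation.Unary.All as All using (All; []; _∷_)
import Data.List.Relation.Unary.All.Properties as All
open import Data.List.Relation.Unary.AllPairs as AllPairs using (AllPairs; []; _∷_)
import Data.List.Relation.Unary.AllPairs.Properties as AllPairs
open import Data.List.Relation.Unary.Any using (here; there)
open import Data.List.Relation.Unary.Linked.Properties using (AllPairs⇒Linked; Linked⇒AllPairs)
open import Data.List.Relation.Unary.Unique.Propositional using (Unique)
import Data.List.Relation.Unary.Unique.Propositional.Properties as Unique
import Data.Maybe.Base as Maybe
open import Data.Nat.Base as ℕ
  using (ℕ; zero; suc; _+_; _*_; _∸_; _≤_; _<_; _>_; _≥_; z≤n; s≤s; parity; _≤′_; ≤′-refl; ≤′-step)
open import Data.Nat.ListAction using (sum)
open import Data.Nat.ListAction.Properties using (sum-++)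
import Data.Nat.Properties as ℕ
open import Data.Product.Base using (_×_; _,_; proj₁; proj₂; ∃)
open import Data.Sum.Base using (_⊎_; inj₁; inj₂)
open import Function.Base using (_∘_)
open import Function.Bundles using (_⇔_; mk⇔; Equivalence)
open import Level using (0ℓ)
open import Relation.Binary.Consequences using (dec⇒weaklyDec)
open import Relation.Binary.Definitions using (WeaklyDecidable)
open import Relation.Binary.PropositionalEquality
  using (_≡_; _≢_; refl; sym; trans; cong; cong₂; subst; module ≡-Reasoning)
import Relation.Binary.Reasoning.Setoid
open import Relation.Binary.Structures using (IsEquivalence)
open import Relation.Nullary using (¬_; yes; no; contradiction)

-- The ring of formal power series

tail : Series → Series
tail f n = f (suc n)

0# 1# : Series
0# = const 0ℤ
1# = const 1ℤ

≈-isEquivalence : IsEquivalence _≈_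
≈-isEquivalence = record
  { refl  = λ _ → refl
  ; sym   = λ f≈g n → sym (f≈g n)
  ; trans = λ f≈g g≈h n → trans (f≈g n) (g≈h n)
  }

0#-at : ∀ n → 0# n ≡ 0ℤ
0#-at zero    = refl
0#-at (suc n) = refl

⊕-cong : ∀ {f f′ g g′} → f ≈ f′ → g ≈ g′ → f ⊕ g ≈ f′ ⊕ g′
⊕-cong f≈ g≈ n = cong₂ ℤ._+_ (f≈ n) (g≈ n)

⊛-cong : ∀ {f f′ g g′} → f ≈ f′ → g ≈ g′ → f ⊛ g ≈ f′ ⊛ g′
⊛-cong f≈ g≈ zero    = cong (ℤ._+ 0ℤ) (cong₂ ℤ._*_ (f≈ 0) (g≈ 0))
⊛-cong f≈ g≈ (suc n) = cong₂ ℤ._+_ (cong₂ ℤ._*_ (f≈ 0) (g≈ (suc n)))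
                                   (⊛-cong (λ i → f≈ (suc i)) g≈ n)

scale-⊛ : ∀ c f g n → ((λ i → c ℤ.* f i) ⊛ g) n ≡ c ℤ.* (f ⊛ g) n
scale-⊛ c f g zero    = lemma c (f 0) (g 0)
  where
  lemma : ∀ a b c → (a ℤ.* b) ℤ.* c ℤ.+ 0ℤ ≡ a ℤ.* (b ℤ.* c ℤ.+ 0ℤ)
  lemma = ℤ-Solver.solve-∀
scale-⊛ c f g (suc n) = trans
  (cong₂ ℤ._+_ (ℤ.*-assoc c (f 0) (g (suc n))) (scale-⊛ c (tail f) g n))
  (sym (ℤ.*-distribˡ-+ c (f 0 ℤ.* g (suc n)) ((tail f ⊛ g) n)))

⊛-distribʳ-⊕ : ∀ h f g → (f ⊕ g) ⊛ h ≈ f ⊛ h ⊕ g ⊛ h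
⊛-distribʳ-⊕ h f g zero    = lemma (f 0) (g 0) (h 0)
  where
  lemma : ∀ a b c → (a ℤ.+ b) ℤ.* c ℤ.+ 0ℤ ≡ (a ℤ.* c ℤ.+ 0ℤ) ℤ.+ (b ℤ.* c ℤ.+ 0ℤ)
  lemma = ℤ-Solver.solve-∀
⊛-distribʳ-⊕ h f g (suc n) = trans
  (cong (ℤ._+_ ((f 0 ℤ.+ g 0) ℤ.* h (suc n))) (⊛-distribʳ-⊕ h (tail f) (tail g) n))
  (lemma (f 0) (g 0) (h (suc n)) _ _)
  where
  lemma : ∀ a b c d e → (a ℤ.+ b) ℤ.* c ℤ.+ (d ℤ.+ e) ≡ (a ℤ.* c ℤ.+ d) ℤ.+ (b ℤ.* c ℤ.+ e)
  lemma = ℤ-Solver.solve-∀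

-- The tail of `f ⊛ g` is `f 0` times `tail g` plus `tail f ⊛ g`, so distributivity and `scale-⊛`
-- reduce coefficient `suc n` to coefficient `n` with `tail f` in place of `f`.
⊛-assoc : ∀ f g h → (f ⊛ g) ⊛ h ≈ f ⊛ (g ⊛ h)
⊛-assoc f g h zero    = lemma (f 0) (g 0) (h 0)
  where
  lemma : ∀ a b c → (a ℤ.* b ℤ.+ 0ℤ) ℤ.* c ℤ.+ 0ℤ ≡ a ℤ.* (b ℤ.* c ℤ.+ 0ℤ) ℤ.+ 0ℤ
  lemma = ℤ-Solver.solve-∀
⊛-assoc f g h (suc n) = begin
  (f 0 ℤ.* g 0 ℤ.+ 0ℤ) ℤ.* h (suc n) ℤ.+ (((λ i → f 0 ℤ.* g (suc i)) ⊕ tail f ⊛ g) ⊛ h) n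
    ≡⟨ cong (ℤ._+_ ((f 0 ℤ.* g 0 ℤ.+ 0ℤ) ℤ.* h (suc n))) (⊛-distribʳ-⊕ h (λ i → f 0 ℤ.* g (suc i)) (tail f ⊛ g) n) ⟩
  (f 0 ℤ.* g 0 ℤ.+ 0ℤ) ℤ.* h (suc n) ℤ.+ (((λ i → f 0 ℤ.* g (suc i)) ⊛ h) n ℤ.+ ((tail f ⊛ g) ⊛ h) n)
    ≡⟨ cong (ℤ._+_ ((f 0 ℤ.* g 0 ℤ.+ 0ℤ) ℤ.* h (suc n))) (cong₂ ℤ._+_ (scale-⊛ (f 0) (tail g) h n) (⊛-assoc (tail f) g h n)) ⟩
  (f 0 ℤ.* g 0 ℤ.+ 0ℤ) ℤ.* h (suc n) ℤ.+ (f 0 ℤ.* (tail g ⊛ h) n ℤ.+ (tail f ⊛ (g ⊛ h)) n)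
    ≡⟨ lemma (f 0) (g 0) (h (suc n)) _ _ ⟩
  f 0 ℤ.* (g 0 ℤ.* h (suc n) ℤ.+ (tail g ⊛ h) n) ℤ.+ (tail f ⊛ (g ⊛ h)) n ∎
  where
  open ≡-Reasoning
  lemma : ∀ a b c d e → (a ℤ.* b ℤ.+ 0ℤ) ℤ.* c ℤ.+ (a ℤ.* d ℤ.+ e) ≡ a ℤ.* (b ℤ.* c ℤ.+ d) ℤ.+ e
  lemma = ℤ-Solver.solve-∀

-- The mirror image of the definitional recursion of ⊛ on its left factor.
⊛-sucʳ : ∀ f g n → (f ⊛ g) (suc n) ≡ f (suc n) ℤ.* g 0 ℤ.+ (f ⊛ tail g) n
⊛-sucʳ f g zero    = lemma (f 0 ℤ.* g 1) (f 1 ℤ.* g 0)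
  where
  lemma : ∀ a b → a ℤ.+ (b ℤ.+ 0ℤ) ≡ b ℤ.+ (a ℤ.+ 0ℤ)
  lemma = ℤ-Solver.solve-∀
⊛-sucʳ f g (suc n) = trans
  (cong (ℤ._+_ (f 0 ℤ.* g (suc (suc n)))) (⊛-sucʳ (tail f) g n))
  (lemma (f 0 ℤ.* g (suc (suc n))) (f (suc (suc n)) ℤ.* g 0) _)
  where
  lemma : ∀ a b c → a ℤ.+ (b ℤ.+ c) ≡ b ℤ.+ (a ℤ.+ c)
  lemma = ℤ-Solver.solve-∀

⊛-comm : ∀ f g → f ⊛ g ≈ g ⊛ f
⊛-comm f g zero    = cong (ℤ._+ 0ℤ) (ℤ.*-comm (f 0) (g 0))
⊛-comm f g (suc n) = trans
  (cong₂ ℤ._+_ (ℤ.*-comm (f 0) (g (suc n))) (⊛-comm (tail f) g n))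
  (sym (⊛-sucʳ g f n))

series : CommutativeRing 0ℓ 0ℓ
series = record
  { _≈_ = _≈_ ; _+_ = _⊕_ ; _*_ = _⊛_ ; -_ = ⊝_ ; 0# = 0# ; 1# = 1#
  ; isCommutativeRing = record
    { isRing = record
      { +-isAbelianGroup = record
        { isGroup = record
          { isMonoid = record
            { isSemigroup = record
              { isMagma = record { isEquivalence = ≈-isEquivalence ; ∙-cong = ⊕-cong }
              ; assoc   = λ f g h n → ℤ.+-assoc (f n) (g n) (h n)
              }
            ; identity = (λ f n → trans (cong (ℤ._+ f n) (0#-at n)) (ℤ.+-identityˡ (f n)))
                       , (λ f n → trans (cong (ℤ._+_ (f n)) (0#-at n)) (ℤ.+-identityʳ (f n)))
            }
          ; inverse = (λ f n → trans (ℤ.+-inverseˡ (f n)) (sym (0#-at n)))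
                    , (λ f n → trans (ℤ.+-inverseʳ (f n)) (sym (0#-at n)))
          ; ⁻¹-cong = λ f≈g n → cong ℤ.-_ (f≈g n)
          }
        ; comm = λ f g n → ℤ.+-comm (f n) (g n)
        }
      ; *-cong     = ⊛-cong
      ; *-assoc    = ⊛-assoc
      ; *-identity = (λ f n → trans (⊛-comm 1# f n) (⊛-identityʳ f n)) , ⊛-identityʳ
      ; distrib    = (λ f g h n → trans (⊛-comm f (g ⊕ h) n) (trans (⊛-distribʳ-⊕ f g h n)
                        (cong₂ ℤ._+_ (⊛-comm g f n) (⊛-comm h f n))))
                   , ⊛-distribʳ-⊕
      }
    ; *-comm = ⊛-comm
    }
  }

-- Gives the ring solver integer coefficients, so that `con (+ 2)` stands for `const (+ 2)`.
const-homo : ℤ.+-*-rawRing -Raw-AlmostCommutative⟶ fromCommutativeRing series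
const-homo = record
  { ⟦_⟧    = const
  ; +-homo = λ { _ _ zero → refl ; _ _ (suc _) → refl }
  ; *-homo = λ { c d zero → sym (ℤ.+-identityʳ (c ℤ.* d)) ; c d (suc n) → sym (const-⊛ c d n) }
  ; -‿homo = λ { _ zero → refl ; _ (suc _) → refl }
  ; 0-homo = λ _ → refl
  ; 1-homo = λ _ → refl
  }
  where
  const-⊛ : ∀ c d n → (const c ⊛ const d) (suc n) ≡ 0ℤ
  const-⊛ c d n = trans (⊛-sucʳ (const c) (const d) n) (trans (ℤ.+-identityˡ _) (⊛-zeroʳ (const c) n))

const-≟ : WeaklyDecidable (Induced-equivalence const-homo)
const-≟ c d = Maybe.map (λ { refl _ → refl }) (dec⇒weaklyDec ℤ._≟_ c d)

module Solver = Algebra.Solver.Ring ℤ.+-*-rawRing (fromCommutativeRing series) const-homo const-≟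
open Solver using (solve; _:=_; _:+_; _:*_; _:-_; :-_; con)
module ≈-Reasoning = Relation.Binary.Reasoning.Setoid (CommutativeRing.setoid series)
open CommutativeRing series using (*-comm; *-identityˡ)
  renaming (refl to ≈-refl; sym to ≈-sym; trans to ≈-trans)

-- The fixed operand is explicit because ⊕ and ⊛ unfold during unification.

⊕-congˡ : ∀ f {g h} → g ≈ h → f ⊕ g ≈ f ⊕ h
⊕-congˡ f = ⊕-cong {f} (λ _ → refl)

⊕-congʳ : ∀ f {g h} → g ≈ h → g ⊕ f ≈ h ⊕ f
⊕-congʳ f g≈h = ⊕-cong {g = f} g≈h (λ _ → refl)

⊖-congˡ : ∀ f {g h} → g ≈ h → f ⊖ g ≈ f ⊖ h
⊖-congˡ f g≈h n = cong (λ c → f n ℤ.- c) (g≈h n)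

⊖-congʳ : ∀ f {g h} → g ≈ h → g ⊖ f ≈ h ⊖ f
⊖-congʳ f g≈h n = cong (ℤ._- f n) (g≈h n)

⊛-congˡ : ∀ f {g h} → g ≈ h → f ⊛ g ≈ f ⊛ h
⊛-congˡ f = ⊛-cong {f} (λ _ → refl)

⊛-congʳ : ∀ f {g h} → g ≈ h → g ⊛ f ≈ h ⊛ f
⊛-congʳ f g≈h = ⊛-cong {g = f} g≈h (λ _ → refl)

-- `poch` grows at its last factor; the induction works because `a ⊛ b ^ suc n` is also
-- `(a ⊛ b) ⊛ b ^ n`, the next entry of the product that starts at `a ⊛ b`.
poch-sucˡ : ∀ a b n → poch a b (suc n) ≈ (1# ⊖ a) ⊛ poch (a ⊛ b) b n
poch-sucˡ a b zero    = solve 1 (λ a → con 1ℤ :* (con 1ℤ :- a :* con 1ℤ) := (con 1ℤ :- a) :* con 1ℤ) ≈-refl a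
poch-sucˡ a b (suc n) = begin
  poch a b (suc n) ⊛ (1# ⊖ a ⊛ b ^ suc n)                ≈⟨ ⊛-congʳ (1# ⊖ a ⊛ b ^ suc n) (poch-sucˡ a b n) ⟩
  (1# ⊖ a) ⊛ poch (a ⊛ b) b n ⊛ (1# ⊖ a ⊛ b ^ suc n)
    ≈⟨ solve 4 (λ a b p c → (con 1ℤ :- a) :* p :* (con 1ℤ :- a :* (c :* b))
                          := (con 1ℤ :- a) :* (p :* (con 1ℤ :- a :* b :* c))) ≈-refl a b (poch (a ⊛ b) b n) (b ^ n) ⟩
  (1# ⊖ a) ⊛ poch (a ⊛ b) b (suc n)                      ∎
  where open ≈-Reasoning

-- Generating functions

^-+ : ∀ f m n → f ^ (m ℕ.+ n) ≈ f ^ m ⊛ f ^ n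
^-+ f zero    n = ≈-sym (*-identityˡ (f ^ n))
^-+ f (suc m) n = begin
  f ^ (m ℕ.+ n) ⊛ f    ≈⟨ ⊛-congʳ f (^-+ f m n) ⟩
  f ^ m ⊛ f ^ n ⊛ f    ≈⟨ solve 3 (λ a b f → a :* b :* f := a :* f :* b) ≈-refl (f ^ m) (f ^ n) f ⟩
  f ^ m ⊛ f ⊛ f ^ n    ∎
  where open ≈-Reasoning

^-cong : ∀ {m n} f → m ≡ n → f ^ m ≈ f ^ n
^-cong f refl = ≈-refl

q²^ : ∀ n → (q ^ 2) ^ n ≈ q ^ n ⊛ q ^ n
q²^ zero    = ≈-sym (*-identityˡ 1#)
q²^ (suc n) = begin
  (q ^ 2) ^ n ⊛ q ^ 2        ≈⟨ ⊛-congʳ (q ^ 2) (q²^ n) ⟩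
  q ^ n ⊛ q ^ n ⊛ q ^ 2      ≈⟨ solve 2 (λ a x → a :* a :* (con 1ℤ :* x :* x) := a :* x :* (a :* x)) ≈-refl (q ^ n) q ⟩
  q ^ suc n ⊛ q ^ suc n      ∎
  where open ≈-Reasoning

q⊛-suc : ∀ f n → (q ⊛ f) (suc n) ≡ f n
q⊛-suc f n = trans (ℤ.+-identityˡ _) (trans (⊛-congʳ f tail-q n) (*-identityˡ f n))
  where
  tail-q : tail q ≈ 1#
  tail-q zero    = refl
  tail-q (suc _) = refl

q^suc⊛ : ∀ p f → q ^ suc p ⊛ f ≈ q ⊛ (q ^ p ⊛ f)
q^suc⊛ p f = solve 3 (λ a x f → a :* x :* f := x :* (a :* f)) ≈-refl (q ^ p) q f

q^⊛-below : ∀ p f n → n < p → (q ^ p ⊛ f) n ≡ 0ℤ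
q^⊛-below (suc p) f zero    _         = q^suc⊛ p f 0
q^⊛-below (suc p) f (suc n) (s≤s n<p) =
  trans (q^suc⊛ p f (suc n)) (trans (q⊛-suc (q ^ p ⊛ f) n) (q^⊛-below p f n n<p))

-- P s enumerates the partitions into distinct parts from {s+1, s+3, s+5, …}.
P : ℕ → Series
P s = poch∞ (⊝ (q ^ suc s)) (q ^ 2)

poch-cong : ∀ {a a′} b n → a ≈ a′ → poch a b n ≈ poch a′ b n
poch-cong b zero    a≈ = ≈-refl
poch-cong b (suc n) a≈ = ⊛-cong (poch-cong b n a≈) (⊖-congˡ 1# (⊛-congʳ (b ^ n) a≈))

poch∞-sucˡ : ∀ a b → b 0 ≡ 0ℤ → poch∞ a b ≈ (1# ⊖ a) ⊛ poch∞ (a ⊛ b) b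
poch∞-sucˡ a b b₀ n =
  -- One factor more than `poch∞` uses at coefficient `n`, so that `suc n` factors remain once the
  -- first is split off.
  trans (sym (poch∞-limit a b b₀ n (suc (suc n)) (ℕ.m≤n⇒m≤1+n ℕ.≤-refl)))
  (trans (poch-sucˡ a b (suc n) n)
         (⊛-cong-≤ (1# ⊖ a) n λ i i≤n → poch∞-limit (a ⊛ b) b b₀ i (suc n) (s≤s i≤n)))

-- The part s+1 is either absent or present once, and the other parts come from {s+3, s+5, ...}.
P-step : ∀ s → P s ≈ (1# ⊕ q ^ suc s) ⊛ P (suc (suc s))
P-step s = begin
  P s                                                       ≈⟨ poch∞-sucˡ (⊝ (q ^ suc s)) (q ^ 2) refl ⟩
  (1# ⊖ ⊝ (q ^ suc s)) ⊛ poch∞ (⊝ (q ^ suc s) ⊛ q ^ 2) (q ^ 2)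
    ≈⟨ ⊛-cong (solve 1 (λ a → con 1ℤ :- (:- a) := con 1ℤ :+ a) ≈-refl (q ^ suc s))
              (λ n → poch-cong (q ^ 2) (suc n) exponent n) ⟩
  (1# ⊕ q ^ suc s) ⊛ P (suc (suc s))                        ∎
  where
  open ≈-Reasoning
  exponent : ⊝ (q ^ suc s) ⊛ q ^ 2 ≈ ⊝ (q ^ suc (suc (suc s)))
  exponent = solve 2 (λ a x → (:- a) :* (con 1ℤ :* x :* x) := :- (a :* x :* x)) ≈-refl (q ^ suc s) q

-- Each factor has the form 1 + q^p b^m and so is 1 modulo q^p.
poch-low : ∀ p b m i → i < p → poch (⊝ (q ^ p)) b m i ≡ 1# i
poch-low p b zero    i i<p = refl
poch-low p b (suc m) i i<p =
  trans (⊛-cong-≤ (poch (⊝ (q ^ p)) b m) i factor)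
        (trans (⊛-identityʳ (poch (⊝ (q ^ p)) b m) i) (poch-low p b m i i<p))
  where
  factor : ∀ l → l ≤ i → (1# ⊖ ⊝ (q ^ p) ⊛ b ^ m) l ≡ 1# l
  factor l l≤i = trans
    (solve 2 (λ x y → con 1ℤ :- (:- x) :* y := con 1ℤ :+ x :* y) ≈-refl (q ^ p) (b ^ m) l)
    (trans (cong (ℤ._+_ (1# l)) (q^⊛-below p (b ^ m) l (ℕ.≤-<-trans l≤i i<p))) (ℤ.+-identityʳ (1# l)))

P-low : ∀ s i → i ≤ s → P s i ≡ 1# i
P-low s i i≤s = poch-low (suc s) (q ^ 2) (suc i) i (s≤s i≤s)

-- S k N = Σ_{s=1}^{N} q^{ks} P s, and F k is its limit, which exists for k ≥ 1.
S : ℕ → ℕ → Series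
S k zero    = 0#
S k (suc N) = S k N ⊕ q ^ (k ℕ.* suc N) ⊛ P (suc N)

F : ℕ → Series
F k n = S k n n

-- The term for s = N+1 is divisible by q^{(k+1)(N+1)}, hence invisible in degrees up to N. For
-- `S 0` this fails, since each of its terms has constant coefficient 1.
S-stable : ∀ k {i N} → i ≤ N → S (suc k) N i ≡ F (suc k) i
S-stable k i≤N = go (ℕ.≤⇒≤′ i≤N)
  where
  go : ∀ {i N} → i ≤′ N → S (suc k) N i ≡ F (suc k) i
  go ≤′-refl               = refl
  go {i} (≤′-step {N} i≤N) = trans
    (cong (ℤ._+_ (S (suc k) N i))
      (q^⊛-below (suc k ℕ.* suc N) (P (suc N)) i
        (ℕ.<-≤-trans (s≤s (ℕ.≤′⇒≤ i≤N)) (ℕ.m≤m+n (suc N) _))))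
    (trans (ℤ.+-identityʳ _) (go i≤N))

-- The recurrence for the sums over the smallest part

module _ (k : ℕ) where
  private
    K = q ^ k

  -- Insert P s = (1 + q^{s+1}) P (s+2) into q^{2k+1} S k N: the two resulting
  -- sums are q S k and S (k+1), without their first two terms.
  S-recurrence : ∀ N →
    K ⊛ K ⊛ q ⊛ S k N ⊕ (const (+ 2) ⊛ (K ⊛ q) ⊛ P 1 ⊕ K ⊛ K ⊛ q ⊛ ((1# ⊕ q) ⊛ P 2))
      ≈ q ⊛ S k (2 ℕ.+ N) ⊕ S (suc k) (2 ℕ.+ N)
  -- Here the sum on the left is empty, and the inhomogeneous part is exactly the terms s = 1 and s
  -- = 2 of both sums on the right.
  S-recurrence zero    = begin
    K ⊛ K ⊛ q ⊛ 0# ⊕ (const (+ 2) ⊛ (K ⊛ q) ⊛ P 1 ⊕ K ⊛ K ⊛ q ⊛ ((1# ⊕ q) ⊛ P 2))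
      ≈⟨ solve 4 (λ K q p₁ p₂ →
             K :* K :* q :* con 0ℤ :+ (con (+ 2) :* (K :* q) :* p₁ :+ K :* K :* q :* ((con 1ℤ :+ q) :* p₂))
          := q :* (con 0ℤ :+ K :* p₁ :+ K :* K :* p₂)
             :+ (con 0ℤ :+ K :* q :* p₁ :+ (K :* q) :* (K :* q) :* p₂)) ≈-refl K q (P 1) (P 2) ⟩
    q ⊛ (0# ⊕ K ⊛ P 1 ⊕ K ⊛ K ⊛ P 2) ⊕ (0# ⊕ q ^ suc k ⊛ P 1 ⊕ q ^ suc k ⊛ q ^ suc k ⊛ P 2)
      ≈⟨ ⊕-cong (⊛-congˡ q (two k)) (two (suc k)) ⟩
    q ⊛ S k 2 ⊕ S (suc k) 2  ∎
    where
    open ≈-Reasoning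
    two : ∀ k → 0# ⊕ q ^ k ⊛ P 1 ⊕ q ^ k ⊛ q ^ k ⊛ P 2 ≈ S k 2
    two k = ⊕-cong
      (⊕-congˡ 0# (⊛-congʳ (P 1) (^-cong q (sym (ℕ.*-identityʳ k)))))
      (⊛-congʳ (P 2) (≈-trans (≈-sym (^-+ q k k))
        (^-cong q (trans (cong (k ℕ.+_) (sym (ℕ.+-identityʳ k))) (ℕ.*-comm 2 k)))))
  S-recurrence (suc N) = begin
    K ⊛ K ⊛ q ⊛ (S k N ⊕ A ⊛ P (suc N)) ⊕ I
      ≈⟨ ⊕-congʳ I (⊛-congˡ (K ⊛ K ⊛ q) (⊕-congˡ (S k N) (⊛-congˡ A (P-step (suc N))))) ⟩
    K ⊛ K ⊛ q ⊛ (S k N ⊕ A ⊛ ((1# ⊕ B) ⊛ P (3 ℕ.+ N))) ⊕ I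
      ≈⟨ solve 7 (λ K q s a b p i → K :* K :* q :* (s :+ a :* ((con 1ℤ :+ b) :* p)) :+ i
                 := (K :* K :* q :* s :+ i) :+ (q :* (K :* K :* a :* p) :+ b :* q :* (K :* K :* a) :* p))
               ≈-refl K q (S k N) A B (P (3 ℕ.+ N)) I ⟩
    (K ⊛ K ⊛ q ⊛ S k N ⊕ I) ⊕ (q ⊛ (K ⊛ K ⊛ A ⊛ P (3 ℕ.+ N)) ⊕ B ⊛ q ⊛ (K ⊛ K ⊛ A) ⊛ P (3 ℕ.+ N))
      -- For s = N+3, `K ⊛ K ⊛ A` is q^{ks}, which gives the new term of `q ⊛ S k`; the factor
      -- `B ⊛ q`, which is q^s, turns q^{ks} into the power in the new term of `S (suc k)`.
      ≈⟨ ⊕-cong (S-recurrence N) (⊕-cong (⊛-congˡ q (⊛-congʳ (P (3 ℕ.+ N)) exponent))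
           (⊛-congʳ (P (3 ℕ.+ N)) (≈-trans (⊛-congˡ (B ⊛ q) exponent) (≈-sym (^-+ q (3 ℕ.+ N) (k ℕ.* (3 ℕ.+ N))))))) ⟩
    (q ⊛ S k (2 ℕ.+ N) ⊕ S (suc k) (2 ℕ.+ N))
      ⊕ (q ⊛ (q ^ (k ℕ.* (3 ℕ.+ N)) ⊛ P (3 ℕ.+ N)) ⊕ q ^ (suc k ℕ.* (3 ℕ.+ N)) ⊛ P (3 ℕ.+ N))
      ≈⟨ solve 5 (λ q s t u v → (q :* s :+ t) :+ (q :* u :+ v) := q :* (s :+ u) :+ (t :+ v))
               ≈-refl q (S k (2 ℕ.+ N)) (S (suc k) (2 ℕ.+ N))
               (q ^ (k ℕ.* (3 ℕ.+ N)) ⊛ P (3 ℕ.+ N)) (q ^ (suc k ℕ.* (3 ℕ.+ N)) ⊛ P (3 ℕ.+ N)) ⟩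
    q ⊛ S k (3 ℕ.+ N) ⊕ S (suc k) (3 ℕ.+ N)  ∎
    where
    open ≈-Reasoning
    A = q ^ (k ℕ.* suc N)
    B = q ^ (2 ℕ.+ N)
    I = const (+ 2) ⊛ (K ⊛ q) ⊛ P 1 ⊕ K ⊛ K ⊛ q ⊛ ((1# ⊕ q) ⊛ P 2)
    exponent : K ⊛ K ⊛ A ≈ q ^ (k ℕ.* (3 ℕ.+ N))
    exponent = ≈-trans (⊛-congʳ A (≈-sym (^-+ q k k))) (≈-trans (≈-sym (^-+ q (k ℕ.+ k) (k ℕ.* suc N)))
      (^-cong q (trans (ℕ.+-assoc k k _)
        (trans (cong (k ℕ.+_) (sym (ℕ.*-suc k (suc N)))) (sym (ℕ.*-suc k (2 ℕ.+ N)))))))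

-- Evaluation of the limits

P₀ P₁ : Series
P₀ = poch∞ (⊝ q) (q ^ 2)
P₁ = poch∞ (⊝ (q ^ 2)) (q ^ 2)

-- Brings the initial term with `P 2` into the form used in the theorem: `P₀` is `P 0` up to
-- `q ^ 1 ≈ q`, whereas `P₁` is `P 1` by definition.
P₀-step : (1# ⊕ q) ⊛ P 2 ≈ P₀
P₀-step = begin
  (1# ⊕ q) ⊛ P 2        ≈⟨ ⊛-congʳ (P 2) (⊕-congˡ 1# (≈-sym (*-identityˡ q))) ⟩
  (1# ⊕ q ^ 1) ⊛ P 2    ≈⟨ P-step 0 ⟨
  P 0                   ≈⟨ (λ n → poch-cong (q ^ 2) (suc n) (λ i → cong ℤ.-_ (*-identityˡ q i)) n) ⟩
  P₀                    ∎
  where open ≈-Reasoning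

-- For k = 0 the coefficient of `q ⊛ S 0 n` in the recurrence is 1, so it cancels against
-- `q ⊛ S 0 (2 + n)` up to the last two terms, q P(n+1) + q P(n+2). By `P-low` both products are 1
-- up to degree n, which leaves 2q.
F-one : F 1 ≈ const (+ 2) ⊛ q ⊛ P₁ ⊕ q ⊛ P₀ ⊖ const (+ 2) ⊛ q
F-one n = trans (sym (S-stable 0 (ℕ.m≤n+m n 2))) (trans (exact n) truncate)
  where
  open ≈-Reasoning
  T : Series → Series → Series
  T a b = const (+ 2) ⊛ q ⊛ P₁ ⊕ q ⊛ P₀ ⊖ (q ⊛ a ⊕ q ⊛ b)
  exact : S 1 (2 ℕ.+ n) ≈ T (P (suc n)) (P (2 ℕ.+ n))
  exact = begin
    S 1 (2 ℕ.+ n)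
      ≈⟨ solve 3 (λ q s t → t := (q :* s :+ t) :- q :* s) ≈-refl q (S 0 (2 ℕ.+ n)) (S 1 (2 ℕ.+ n)) ⟩
    (q ⊛ S 0 (2 ℕ.+ n) ⊕ S 1 (2 ℕ.+ n)) ⊖ q ⊛ S 0 (2 ℕ.+ n)
      ≈⟨ ⊖-congʳ (q ⊛ S 0 (2 ℕ.+ n)) (S-recurrence 0 n) ⟨
    (1# ⊛ 1# ⊛ q ⊛ S 0 n ⊕ (const (+ 2) ⊛ (1# ⊛ q) ⊛ P 1 ⊕ 1# ⊛ 1# ⊛ q ⊛ ((1# ⊕ q) ⊛ P 2)))
      ⊖ q ⊛ (S 0 n ⊕ 1# ⊛ P (suc n) ⊕ 1# ⊛ P (2 ℕ.+ n))
      ≈⟨ ⊖-congʳ (q ⊛ S 0 (2 ℕ.+ n)) (⊕-congˡ (1# ⊛ 1# ⊛ q ⊛ S 0 n)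
           (⊕-congˡ (const (+ 2) ⊛ (1# ⊛ q) ⊛ P₁) (⊛-congˡ (1# ⊛ 1# ⊛ q) P₀-step))) ⟩
    (1# ⊛ 1# ⊛ q ⊛ S 0 n ⊕ (const (+ 2) ⊛ (1# ⊛ q) ⊛ P 1 ⊕ 1# ⊛ 1# ⊛ q ⊛ P₀))
      ⊖ q ⊛ (S 0 n ⊕ 1# ⊛ P (suc n) ⊕ 1# ⊛ P (2 ℕ.+ n))
      ≈⟨ solve 6 (λ q s p₁ p₀ a b →
           (con 1ℤ :* con 1ℤ :* q :* s :+ (con (+ 2) :* (con 1ℤ :* q) :* p₁ :+ con 1ℤ :* con 1ℤ :* q :* p₀))
             :- q :* (s :+ con 1ℤ :* a :+ con 1ℤ :* b)
           := con (+ 2) :* q :* p₁ :+ q :* p₀ :- (q :* a :+ q :* b))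
           ≈-refl q (S 0 n) P₁ P₀ (P (suc n)) (P (2 ℕ.+ n)) ⟩
    T (P (suc n)) (P (2 ℕ.+ n))  ∎
  truncate : T (P (suc n)) (P (2 ℕ.+ n)) n ≡ (const (+ 2) ⊛ q ⊛ P₁ ⊕ q ⊛ P₀ ⊖ const (+ 2) ⊛ q) n
  truncate = trans
    (cong (λ z → (const (+ 2) ⊛ q ⊛ P₁ ⊕ q ⊛ P₀) n ℤ.- z) (cong₂ ℤ._+_
      (⊛-cong-≤ q n λ i i≤n → P-low (suc n) i (ℕ.m≤n⇒m≤1+n i≤n))
      (⊛-cong-≤ q n λ i i≤n → P-low (2 ℕ.+ n) i (ℕ.m≤n⇒m≤1+n (ℕ.m≤n⇒m≤1+n i≤n)))))
    (solve 3 (λ q p₁ p₀ → con (+ 2) :* q :* p₁ :+ q :* p₀ :- (q :* con 1ℤ :+ q :* con 1ℤ)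
                       := con (+ 2) :* q :* p₁ :+ q :* p₀ :- con (+ 2) :* q) ≈-refl q P₁ P₀ n)

-- The coefficientwise limit of `S-recurrence`, which exists because the index is positive.
F-suc : ∀ k → let K = q ^ suc k in
  F (suc (suc k)) ≈ (K ⊛ K ⊛ q ⊖ q) ⊛ F (suc k) ⊕ (const (+ 2) ⊛ (K ⊛ q) ⊛ P₁ ⊕ K ⊛ K ⊛ q ⊛ P₀)
F-suc k = begin
  F (suc (suc k))
    ≈⟨ solve 3 (λ q s t → t := (q :* s :+ t) :- q :* s) ≈-refl q (F (suc k)) (F (suc (suc k))) ⟩
  (q ⊛ F (suc k) ⊕ F (suc (suc k))) ⊖ q ⊛ F (suc k)
    ≈⟨ ⊖-congʳ (q ⊛ F (suc k)) limit ⟨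
  (K ⊛ K ⊛ q ⊛ F (suc k) ⊕ I ((1# ⊕ q) ⊛ P 2)) ⊖ q ⊛ F (suc k)
    ≈⟨ ⊖-congʳ (q ⊛ F (suc k)) (⊕-congˡ (K ⊛ K ⊛ q ⊛ F (suc k))
         (⊕-congˡ (const (+ 2) ⊛ (K ⊛ q) ⊛ P₁) (⊛-congˡ (K ⊛ K ⊛ q) P₀-step))) ⟩
  (K ⊛ K ⊛ q ⊛ F (suc k) ⊕ I P₀) ⊖ q ⊛ F (suc k)
    ≈⟨ solve 4 (λ c q s i → (c :* s :+ i) :- q :* s := (c :- q) :* s :+ i) ≈-refl (K ⊛ K ⊛ q) q (F (suc k)) (I P₀) ⟩
  (K ⊛ K ⊛ q ⊖ q) ⊛ F (suc k) ⊕ I P₀  ∎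
  where
  open ≈-Reasoning
  K = q ^ suc k
  I : Series → Series
  I p = const (+ 2) ⊛ (K ⊛ q) ⊛ P₁ ⊕ K ⊛ K ⊛ q ⊛ p
  limit : K ⊛ K ⊛ q ⊛ F (suc k) ⊕ I ((1# ⊕ q) ⊛ P 2) ≈ q ⊛ F (suc k) ⊕ F (suc (suc k))
  -- For coefficient `n` the truncation `N = n` suffices: all three sums are stable there.
  limit n = trans
    (cong (ℤ._+ I ((1# ⊕ q) ⊛ P 2) n) (⊛-cong-≤ (K ⊛ K ⊛ q) n λ i i≤n → sym (S-stable k i≤n)))
    (trans (S-recurrence (suc k) n n)
      (cong₂ ℤ._+_ (⊛-cong-≤ q n λ i i≤n → S-stable k (ℕ.≤-trans i≤n (ℕ.m≤n+m n 2)))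
                   (S-stable (suc k) (ℕ.m≤n+m n 2))))

-- Induction on `k` with `F-suc`: the coefficients of `P₁` and `P₀` follow the recurrences defining
-- `V` and `W`.
F-closed : ∀ k → F (suc k) ≈
  V (suc k) ⊛ P₁ ⊕ W (suc k) ⊛ P₀ ⊕ const (+ 2) ⊛ (⊝ q) ^ suc k ⊛ poch (q ^ 2) (q ^ 2) k
F-closed zero    = ≈-trans F-one
  (solve 3 (λ q p₁ p₀ → con (+ 2) :* q :* p₁ :+ q :* p₀ :- con (+ 2) :* q
     := con (+ 2) :* q :* p₁ :+ q :* p₀ :+ con (+ 2) :* (con 1ℤ :* (:- q)) :* con 1ℤ) ≈-refl q P₁ P₀)
F-closed (suc k) = begin
  F (suc (suc k))
    ≈⟨ F-suc k ⟩
  (K ⊛ K ⊛ q ⊖ q) ⊛ F (suc k) ⊕ (const (+ 2) ⊛ (K ⊛ q) ⊛ P₁ ⊕ K ⊛ K ⊛ q ⊛ P₀)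
    ≈⟨ ⊕-congʳ (const (+ 2) ⊛ (K ⊛ q) ⊛ P₁ ⊕ K ⊛ K ⊛ q ⊛ P₀) (⊛-congˡ (K ⊛ K ⊛ q ⊖ q) (F-closed k)) ⟩
  (K ⊛ K ⊛ q ⊖ q) ⊛ (V (suc k) ⊛ P₁ ⊕ W (suc k) ⊛ P₀ ⊕ const (+ 2) ⊛ N ⊛ R)
      ⊕ (const (+ 2) ⊛ (K ⊛ q) ⊛ P₁ ⊕ K ⊛ K ⊛ q ⊛ P₀)
    -- In the last summand, K²q - q = (-q)(1 - K²) supplies one more factor to the power of -q and
    -- one to the Pochhammer symbol.
    ≈⟨ solve 8 (λ K q v w p₁ p₀ n r →
         (K :* K :* q :- q) :* (v :* p₁ :+ w :* p₀ :+ con (+ 2) :* n :* r)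
           :+ (con (+ 2) :* (K :* q) :* p₁ :+ K :* K :* q :* p₀)
         := ((K :* K :* q :- q) :* v :+ con (+ 2) :* (K :* q)) :* p₁
           :+ ((K :* K :* q :- q) :* w :+ K :* K :* q) :* p₀
           :+ con (+ 2) :* (n :* (:- q)) :* (r :* (con 1ℤ :- K :* K)))
         ≈-refl K q (V (suc k)) (W (suc k)) P₁ P₀ N R ⟩
  ((K ⊛ K ⊛ q ⊖ q) ⊛ V (suc k) ⊕ const (+ 2) ⊛ (K ⊛ q)) ⊛ P₁
    ⊕ ((K ⊛ K ⊛ q ⊖ q) ⊛ W (suc k) ⊕ K ⊛ K ⊛ q) ⊛ P₀
    ⊕ const (+ 2) ⊛ (N ⊛ ⊝ q) ⊛ (R ⊛ (1# ⊖ K ⊛ K))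
    ≈⟨ ⊕-cong (⊕-cong (⊛-congʳ P₁ (⊕-congʳ (const (+ 2) ⊛ (K ⊛ q)) (⊛-congʳ (V (suc k)) (⊖-congʳ q exponent))))
                      (⊛-congʳ P₀ (⊕-cong (⊛-congʳ (W (suc k)) (⊖-congʳ q exponent)) exponent)))
              (⊛-congˡ (const (+ 2) ⊛ (N ⊛ ⊝ q)) (⊛-congˡ R (⊖-congˡ 1# square))) ⟩
  V (suc (suc k)) ⊛ P₁ ⊕ W (suc (suc k)) ⊛ P₀
    ⊕ const (+ 2) ⊛ (⊝ q) ^ suc (suc k) ⊛ poch (q ^ 2) (q ^ 2) (suc k)  ∎
  where
  open ≈-Reasoning
  K = q ^ suc k
  N = (⊝ q) ^ suc k
  R = poch (q ^ 2) (q ^ 2) k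
  exponent : K ⊛ K ⊛ q ≈ q ^ (2 ℕ.* suc (suc k) ∸ 1)
  exponent = ≈-trans (⊛-congʳ q (≈-sym (^-+ q (suc k) (suc k))))
    (^-cong {suc (suc k ℕ.+ suc k)} q
      (trans (sym (ℕ.+-suc (suc k) (suc k))) (cong (λ j → suc k ℕ.+ suc (suc j)) (sym (ℕ.+-identityʳ k)))))
  square : K ⊛ K ≈ q ^ 2 ⊛ (q ^ 2) ^ k
  square = ≈-trans (≈-sym (q²^ (suc k))) (*-comm ((q ^ 2) ^ k) (q ^ 2))

-- Enumeration of the partitions

-- The counterpart for families of lists of multiplication by q^p, empty below degree p.
shift : ∀ {A : Set} → ℕ → (ℕ → List A) → ℕ → List A
shift zero    f n       = f n
shift (suc p) f zero    = []
shift (suc p) f (suc n) = shift p f n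

module _ {A : Set} {f : ℕ → List A} where

  length-shift : ∀ {g} → (∀ m → + length (f m) ≡ g m) →
                 ∀ p n → + length (shift p f n) ≡ (q ^ p ⊛ g) n
  length-shift {g} eq zero    n       = trans (eq n) (sym (*-identityˡ g n))
  length-shift {g} eq (suc p) zero    = sym (q^⊛-below (suc p) g 0 (s≤s z≤n))
  length-shift {g} eq (suc p) (suc n) = trans (length-shift eq p n)
    (sym (trans (q^suc⊛ p g (suc n)) (q⊛-suc (q ^ p ⊛ g) n)))

  ∈-shift⁺ : ∀ p {m x} → x ∈ f m → x ∈ shift p f (p + m)
  ∈-shift⁺ zero    x∈ = x∈
  ∈-shift⁺ (suc p) x∈ = ∈-shift⁺ p x∈

  ∈-shift⁻ : ∀ p n {x} → x ∈ shift p f n → ∃ λ m → n ≡ p + m × x ∈ f m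
  ∈-shift⁻ zero    n       x∈ = n , refl , x∈
  ∈-shift⁻ (suc p) (suc n) x∈ with m , eq , x∈′ ← ∈-shift⁻ p n x∈ = m , cong suc eq , x∈′

  shift-unique : (∀ m → Unique (f m)) → ∀ p n → Unique (shift p f n)
  shift-unique u zero    n       = u n
  shift-unique u (suc p) zero    = []
  shift-unique u (suc p) (suc n) = shift-unique u p n

-- Partitions into distinct parts s+1, s+3, ...

part : ℕ → ℕ → ℕ
part s i = suc s + (i + i)

part-mono-< : ∀ s {i j} → i < j → part s i < part s j
part-mono-< s i<j = ℕ.+-monoʳ-< (suc s) (ℕ.+-mono-< i<j i<j)

part-cancel-< : ∀ s {i j} → part s i < part s j → i < j
part-cancel-< s {i} {j} lt with i ℕ.<? j
... | yes i<j = i<j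
... | no  i≮j = contradiction lt (ℕ.≤⇒≯ (ℕ.+-monoʳ-≤ (suc s) (ℕ.+-mono-≤ (ℕ.≮⇒≥ i≮j) (ℕ.≮⇒≥ i≮j))))

-- The partitions of m into distinct parts from {s+1, s+3, …, s+2j-1}, largest part first.
distinctPartitions : ℕ → ℕ → ℕ → List (List ℕ)
distinctPartitions s zero    zero    = [] ∷ []
distinctPartitions s zero    (suc m) = []
distinctPartitions s (suc j) m       =
  distinctPartitions s j m ++ shift (part s j) (λ m′ → map (part s j ∷_) (distinctPartitions s j m′)) m

-- The sublists without and with `part s j` account for the two terms of the factor 1 + q^{s+1+2j}
-- that `poch` gains.
length-distinctPartitions : ∀ s j m →
  + length (distinctPartitions s j m) ≡ poch (⊝ (q ^ suc s)) (q ^ 2) j m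
length-distinctPartitions s zero    zero    = refl
length-distinctPartitions s zero    (suc m) = refl
length-distinctPartitions s (suc j) m       = begin
  + length (D m ++ shift p (λ m′ → map (p ∷_) (D m′)) m)
    ≡⟨ cong +_ (length-++ (D m)) ⟩
  + length (D m) ℤ.+ + length (shift p (λ m′ → map (p ∷_) (D m′)) m)
    ≡⟨ cong₂ ℤ._+_ (length-distinctPartitions s j m) (length-shift
         (λ m′ → trans (cong +_ (length-map (p ∷_) (D m′))) (length-distinctPartitions s j m′)) p m) ⟩
  (g ⊕ q ^ p ⊛ g) m
    ≡⟨ ⊕-congˡ g (⊛-congʳ g power) m ⟩
  (g ⊕ q ^ suc s ⊛ (q ^ 2) ^ j ⊛ g) m
    ≡⟨ solve 3 (λ g a b → g :+ a :* b :* g := g :* (con 1ℤ :- (:- a) :* b)) ≈-refl g (q ^ suc s) ((q ^ 2) ^ j) m ⟩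
  (g ⊛ (const 1ℤ ⊖ ⊝ (q ^ suc s) ⊛ (q ^ 2) ^ j)) m
    ∎
  where
  open ≡-Reasoning
  p = part s j
  D = distinctPartitions s j
  g = poch (⊝ (q ^ suc s)) (q ^ 2) j
  power : q ^ p ≈ q ^ suc s ⊛ (q ^ 2) ^ j
  power = ≈-trans (^-+ q (suc s) (j + j))
    (⊛-congˡ (q ^ suc s) (≈-trans (^-+ q j j) (≈-sym (q²^ j))))

Indexed : ℕ → ℕ → ℕ → Set
Indexed s j p = ∃ λ i → i < j × p ≡ part s i

∈-distinctPartitions⁻ : ∀ s j m {d} → d ∈ distinctPartitions s j m →
  AllPairs _>_ d × All (Indexed s j) d × sum d ≡ m
∈-distinctPartitions⁻ s zero    zero (here refl) = [] , [] , refl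
∈-distinctPartitions⁻ s (suc j) m d∈ with ∈-++⁻ (distinctPartitions s j m) d∈
... | inj₁ d∈ˡ with >d , ind , eq ← ∈-distinctPartitions⁻ s j m d∈ˡ =
  >d , All.map (λ (i , i<j , p≡) → i , ℕ.m≤n⇒m≤1+n i<j , p≡) ind , eq
... | inj₂ d∈ʳ
  with m′ , refl , d∈ᵐ ← ∈-shift⁻ (part s j) m d∈ʳ
  with e , e∈ , refl ← ∈-map⁻ (part s j ∷_) d∈ᵐ
  with >e , ind , refl ← ∈-distinctPartitions⁻ s j m′ e∈ =
    All.map (λ { (i , i<j , refl) → part-mono-< s i<j }) ind ∷ >e
  , (j , ℕ.≤-refl , refl) ∷ All.map (λ (i , i<j , p≡) → i , ℕ.m≤n⇒m≤1+n i<j , p≡) ind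
  , refl

∈-distinctPartitions⁺ : ∀ s j {d} → AllPairs _>_ d → All (Indexed s j) d →
  d ∈ distinctPartitions s j (sum d)
∈-distinctPartitions⁺ s zero    []        []              = here refl
∈-distinctPartitions⁺ s zero    (_ ∷ _)   ((_ , () , _) ∷ _)
∈-distinctPartitions⁺ s (suc j) []        []              = ∈-++⁺ˡ (∈-distinctPartitions⁺ s j [] [])
∈-distinctPartitions⁺ s (suc j) {d = _ ∷ e} (>e ∷ >>e) ((i , s≤s i≤j , refl) ∷ ind)
  with ℕ.m≤n⇒m<n∨m≡n i≤j
-- A head of index below `j` forces, by strict decrease, all later indices below `j` as well.
... | inj₁ i<j  = ∈-++⁺ˡ (∈-distinctPartitions⁺ s j (>e ∷ >>e)
      ((i , i<j , refl) ∷ All.zipWith (λ { (lt , l , _ , refl) → l , ℕ.<-trans (part-cancel-< s lt) i<j , refl }) (>e , ind)))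
... | inj₂ refl = ∈-++⁺ʳ (distinctPartitions s j (part s j + sum e)) (∈-shift⁺ (part s j)
      (∈-map⁺ (part s j ∷_) (∈-distinctPartitions⁺ s j >>e
        (All.zipWith (λ { (lt , l , _ , refl) → l , part-cancel-< s lt , refl }) (>e , ind)))))

-- The two sublists are disjoint: one contains `part s j` as head, the other only parts of smaller
-- index.
distinctPartitions-unique : ∀ s j m → Unique (distinctPartitions s j m)
distinctPartitions-unique s zero    zero    = [] ∷ []
distinctPartitions-unique s zero    (suc m) = []
distinctPartitions-unique s (suc j) m       = Unique.++⁺
  (distinctPartitions-unique s j m)
  (shift-unique (λ m′ → Unique.map⁺ ∷-injectiveʳ (distinctPartitions-unique s j m′)) (part s j) m)
  disjoint
  where
  disjoint : Disjoint (distinctPartitions s j m)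
                      (shift (part s j) (λ m′ → map (part s j ∷_) (distinctPartitions s j m′)) m)
  disjoint (l , r)
    with m′ , refl , r′ ← ∈-shift⁻ (part s j) m r
    with e , _ , refl ← ∈-map⁻ (part s j ∷_) r′
    with _ , (i , i<j , eq) ∷ _ , _ ← ∈-distinctPartitions⁻ s j m l =
      ℕ.<⇒≢ (part-mono-< s i<j) (sym eq)

-- Parity of the remaining parts

parity-+-double : ∀ n i → parity (n + (i + i)) ≡ parity n
parity-+-double n zero    = cong parity (ℕ.+-identityʳ n)
parity-+-double n (suc i) = trans
  (cong parity (trans (cong (λ x → n + suc x) (ℕ.+-suc i i))
                      (trans (ℕ.+-suc n (suc (i + i))) (cong suc (ℕ.+-suc n (i + i))))))
  (parity-+-double n i)

parity-suc : ∀ n → parity (suc n) ≢ parity n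
parity-suc zero          ()
parity-suc (suc zero)    ()
parity-suc (suc (suc n)) = parity-suc n

double-or-suc-double : ∀ n → (∃ λ i → n ≡ i + i) ⊎ (∃ λ i → n ≡ suc (i + i))
double-or-suc-double zero    = inj₁ (0 , refl)
double-or-suc-double (suc n) with double-or-suc-double n
... | inj₁ (i , refl) = inj₂ (i , refl)
... | inj₂ (i , refl) = inj₁ (suc i , cong suc (sym (ℕ.+-suc i i)))

Larger : ℕ → ℕ → Set
Larger s p = s < p × parity p ≢ parity s

part-larger : ∀ s i → Larger s (part s i)
part-larger s i = ℕ.m≤m+n (suc s) (i + i) , λ eq → parity-suc s (trans (sym (parity-+-double (suc s) i)) eq)

-- Write p = s+1+o; an odd o would give p the parity of s.
larger-part : ∀ {s p} → Larger s p → ∃ λ i → p ≡ part s i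
larger-part {s} (s<p , par) with ℕ.m≤n⇒∃[o]m+o≡n s<p
... | o , refl with double-or-suc-double o
...   | inj₁ (i , refl) = i , refl
...   | inj₂ (i , refl) =
  contradiction (trans (cong (parity ∘ suc) (ℕ.+-suc s (i + i))) (parity-+-double s i)) par

∈⇒≤sum : ∀ {x xs} → x ∈ xs → x ≤ sum xs
∈⇒≤sum {xs = x ∷ xs} (here refl) = ℕ.m≤m+n x (sum xs)
∈⇒≤sum {xs = y ∷ xs} (there x∈)  = ℕ.≤-trans (∈⇒≤sum x∈) (ℕ.m≤n+m (sum xs) y)

-- The cutoff `suc m` excludes nothing, since a part of index `i` is at least `i` and at most `m`.
-- It is also the number of factors that `poch∞` uses at coefficient `m`.
∈-distinctPartitions : ∀ s m {d} →
  d ∈ distinctPartitions s (suc m) m ⇔ (AllPairs _>_ d × All (Larger s) d × sum d ≡ m)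
∈-distinctPartitions s m {d} = mk⇔ to from
  where
  to : d ∈ distinctPartitions s (suc m) m → AllPairs _>_ d × All (Larger s) d × sum d ≡ m
  to d∈ with >d , ind , eq ← ∈-distinctPartitions⁻ s (suc m) m d∈ =
    >d , All.map (λ { (i , _ , refl) → part-larger s i }) ind , eq
  index : ∀ {p} → Larger s p → p ≤ sum d → Indexed s (suc (sum d)) p
  index l p≤ with i , refl ← larger-part l =
    i , s≤s (ℕ.≤-trans (ℕ.m≤m+n i i) (ℕ.≤-trans (ℕ.m≤n+m (i + i) (suc s)) p≤)) , refl
  from : AllPairs _>_ d × All (Larger s) d × sum d ≡ m → d ∈ distinctPartitions s (suc m) m
  from (>d , lg , refl) = ∈-distinctPartitions⁺ s (suc (sum d)) >d
    (All.tabulate λ p∈ → index (All.lookup lg p∈) (∈⇒≤sum p∈))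

-- Splitting off the copies of the smallest part

smallest-≡ : ∀ {s} π → s ∈ π → All (s ≤_) π → smallest π ≡ s
smallest-≡ {s} (x ∷ xs) s∈ (s≤x ∷ s≤xs) = ℕ.≤-antisym (below s∈) (v≤min⁺ s≤x s≤xs)
  where
  below : s ∈ x ∷ xs → smallest (x ∷ xs) ≤ s
  below (here refl) = min≤⊤ x xs
  below (there s∈)  = All.lookup (min≤xs x xs) s∈

smallest-≤ : ∀ π → All (smallest π ≤_) π
smallest-≤ []       = []
smallest-≤ (x ∷ xs) = min≤⊤ x xs ∷ min≤xs x xs

sum-replicate : ∀ k s → sum (replicate k s) ≡ k * s
sum-replicate zero    s = refl
sum-replicate (suc k) s = cong (ℕ._+_ s) (sum-replicate k s)

all-≡⇒replicate : ∀ {s : ℕ} {xs} → All (s ≡_) xs → xs ≡ replicate (length xs) s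
all-≡⇒replicate []          = refl
all-≡⇒replicate (refl ∷ eq) = cong (_ ∷_) (all-≡⇒replicate eq)

-- Once an entry equals `s`, all later ones lie between `s` and `s`, so the rest of the list is
-- constant.
nonincreasing-split : ∀ s {π} → AllPairs _≥_ π → All (s ≤_) π →
  π ≡ filter (s ℕ.<?_) π ++ replicate (occurrences s π) s
nonincreasing-split s []                 []           = refl
nonincreasing-split s {x ∷ π} (x≥ ∷ ≥π) (s≤x ∷ s≤π) with ℕ.m≤n⇒m<n∨m≡n s≤x
... | inj₁ s<x rewrite filter-accept (s ℕ.<?_) {xs = π} s<x | filter-reject (s ℕ.≟_) {xs = π} (ℕ.<⇒≢ s<x) =
  cong (x ∷_) (nonincreasing-split s ≥π s≤π)
... | inj₂ refl
  rewrite filter-reject (s ℕ.<?_) {xs = π} (ℕ.<-irrefl {s} refl)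
        | filter-accept (s ℕ.≟_) {xs = π} refl
        | filter-none (s ℕ.<?_) (All.map ℕ.≤⇒≯ x≥) =
  cong (s ∷_) (trans (all-≡⇒replicate all≡) (cong (λ xs → replicate (length xs) s) (sym (filter-all (s ℕ.≟_) all≡))))
  where
  all≡ : All (s ≡_) π
  all≡ = All.zipWith (λ (a , b) → ℕ.≤-antisym a b) (s≤π , x≥)

module _ (k s : ℕ) {d : List ℕ} (>d : AllPairs _>_ d) (larger : All (Larger s) d) where
  private
    r = replicate (suc k) s
    π = d ++ r

  -- The multiplicity `suc k` guarantees that `s` occurs, and every part of `d` exceeds it.
  smallest-++-replicate : smallest π ≡ s
  smallest-++-replicate = smallest-≡ π (∈-++⁺ʳ d (here refl))
    (All.++⁺ (All.map (ℕ.<⇒≤ ∘ proj₁) larger) (All.replicate⁺ (suc k) ℕ.≤-refl))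

  private
    occurrences-++-replicate : occurrences s π ≡ suc k
    occurrences-++-replicate = begin
      length (filter (s ℕ.≟_) (d ++ r))                     ≡⟨ cong length (filter-++ (s ℕ.≟_) d r) ⟩
      length (filter (s ℕ.≟_) d ++ filter (s ℕ.≟_) r)
        ≡⟨ cong₂ (λ xs ys → length (xs ++ ys))
             (filter-none (s ℕ.≟_) (All.map (ℕ.<⇒≢ ∘ proj₁) larger))
             (filter-all (s ℕ.≟_) {r} (All.replicate⁺ (suc k) refl)) ⟩
      length r                                              ≡⟨ length-replicate (suc k) ⟩
      suc k                                                 ∎
      where open ≡-Reasoning

    remaining-++-replicate : filter (s ℕ.<?_) π ≡ d
    remaining-++-replicate = begin
      filter (s ℕ.<?_) (d ++ r)                      ≡⟨ filter-++ (s ℕ.<?_) d r ⟩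
      filter (s ℕ.<?_) d ++ filter (s ℕ.<?_) r
        ≡⟨ cong₂ _++_ (filter-all (s ℕ.<?_) (All.map proj₁ larger))
             (filter-none (s ℕ.<?_) {r} (All.replicate⁺ (suc k) (ℕ.<-irrefl refl))) ⟩
      d ++ []                                        ≡⟨ ++-identityʳ d ⟩
      d                                              ∎
      where open ≡-Reasoning

    replicate-≥ : ∀ j → AllPairs _≥_ (replicate j s)
    replicate-≥ zero    = []
    replicate-≥ (suc j) = All.replicate⁺ j ℕ.≤-refl ∷ replicate-≥ j

  ++-replicate-Sptdo : 1 ≤ s → Sptdo (suc k) (suc k * s + sum d) π
  ++-replicate-Sptdo 1≤s = sptdoPartition
    (isPartition
      (AllPairs⇒Linked (AllPairs.++⁺ (AllPairs.map ℕ.<⇒≤ >d) (replicate-≥ (suc k))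
        (All.map (λ (s<p , _) → All.replicate⁺ (suc k) (ℕ.<⇒≤ s<p)) larger)))
      (All.++⁺ (All.map (λ (s<p , _) → ℕ.≤-trans 1≤s (ℕ.<⇒≤ s<p)) larger) (All.replicate⁺ (suc k) 1≤s))
      (trans (sum-++ d r) (trans (cong (ℕ._+_ (sum d)) (sum-replicate (suc k) s)) (ℕ.+-comm (sum d) (suc k * s)))))
    (subst (λ t → occurrences t π ≡ suc k) (sym smallest-++-replicate) occurrences-++-replicate)
    (subst Unique (sym remaining≡) (AllPairs.map (λ lt eq → ℕ.<⇒≢ lt (sym eq)) >d))
    (subst (All _) (sym remaining≡)
      (All.map (λ (_ , par) → subst (λ t → _ ≢ parity t) (sym smallest-++-replicate) par) larger))
    where
    remaining≡ : remaining π ≡ d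
    remaining≡ = trans (cong (λ t → filter (t ℕ.<?_) π) smallest-++-replicate) remaining-++-replicate

-- The partitions of n counted by sptdo k whose smallest part s is at most N.
sptdoUpTo : ℕ → ℕ → ℕ → List (List ℕ)
sptdoUpTo k zero    n = []
sptdoUpTo k (suc N) n = sptdoUpTo k N n ++
  shift (k * suc N) (λ m → map (_++ replicate k (suc N)) (distinctPartitions (suc N) (suc m) m)) n

-- For s = N+1, the shift by `k * s` contributes q^{ks} and the choice of the remaining parts
-- contributes `P s`.
length-sptdoUpTo : ∀ k N n → + length (sptdoUpTo k N n) ≡ S k N n
length-sptdoUpTo k zero    n = sym (0#-at n)
length-sptdoUpTo k (suc N) n = trans (cong +_ (length-++ (sptdoUpTo k N n)))
  (cong₂ ℤ._+_ (length-sptdoUpTo k N n)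
    (length-shift (λ m → trans (cong +_ (length-map (_++ replicate k (suc N)) (distinctPartitions (suc N) (suc m) m)))
                               (length-distinctPartitions (suc N) (suc m) m))
                  (k * suc N) n))

∈-sptdoUpTo⁺ : ∀ k {s N m d} → 1 ≤ s → s ≤ N → d ∈ distinctPartitions s (suc m) m →
  d ++ replicate k s ∈ sptdoUpTo k N (k * s + m)
∈-sptdoUpTo⁺ k {s} {suc N} {m} {d} 1≤s s≤ d∈ with ℕ.m≤n⇒m<n∨m≡n s≤
... | inj₁ (s≤s s≤N) = ∈-++⁺ˡ (∈-sptdoUpTo⁺ k 1≤s s≤N d∈)
... | inj₂ refl      = ∈-++⁺ʳ (sptdoUpTo k N (k * s + m))
  (∈-shift⁺ (k * s) (∈-map⁺ (_++ replicate k s) d∈))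
∈-sptdoUpTo⁺ k {N = zero} (s≤s _) ()

∈-shift-++-replicate⁻ : ∀ k s n {π} →
  π ∈ shift (k * s) (λ m → map (_++ replicate k s) (distinctPartitions s (suc m) m)) n →
  ∃ λ d → AllPairs _>_ d × All (Larger s) d × n ≡ k * s + sum d × π ≡ d ++ replicate k s
∈-shift-++-replicate⁻ k s n π∈
  with m , refl , π∈ᵐ ← ∈-shift⁻ (k * s) n π∈
  with d , d∈ , refl ← ∈-map⁻ (_++ replicate k s) π∈ᵐ
  with >d , lg , refl ← Equivalence.to (∈-distinctPartitions s m) d∈ =
  d , >d , lg , refl , refl

-- The bound on `smallest π` serves to separate the blocks in `sptdoUpTo-unique`: the block added
-- for `suc N` has smallest part `suc N`.
∈-sptdoUpTo⁻ : ∀ k N {n π} → π ∈ sptdoUpTo (suc k) N n → Sptdo (suc k) n π × smallest π ≤ N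
∈-sptdoUpTo⁻ k (suc N) {n} π∈ with ∈-++⁻ (sptdoUpTo (suc k) N n) π∈
... | inj₁ π∈ˡ with sp , s≤N ← ∈-sptdoUpTo⁻ k N π∈ˡ = sp , ℕ.m≤n⇒m≤1+n s≤N
... | inj₂ π∈ʳ with d , >d , lg , refl , refl ← ∈-shift-++-replicate⁻ (suc k) (suc N) n π∈ʳ =
  ++-replicate-Sptdo k (suc N) >d lg (s≤s z≤n) , ℕ.≤-reflexive (smallest-++-replicate k (suc N) >d lg)

sptdoUpTo-unique : ∀ k N n → Unique (sptdoUpTo (suc k) N n)
sptdoUpTo-unique k zero    n = []
sptdoUpTo-unique k (suc N) n = Unique.++⁺
  (sptdoUpTo-unique k N n)
  (shift-unique (λ m → Unique.map⁺ (λ {d} {e} → ++-cancelʳ (replicate (suc k) (suc N)) d e)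
                                   (distinctPartitions-unique (suc N) (suc m) m))
                (suc k * suc N) n)
  λ (l , r) → disjoint l (∈-shift-++-replicate⁻ (suc k) (suc N) n r)
  where
  disjoint : ∀ {π} → π ∈ sptdoUpTo (suc k) N n →
    ¬ ∃ λ d → AllPairs _>_ d × All (Larger (suc N)) d × n ≡ suc k * suc N + sum d × π ≡ d ++ replicate (suc k) (suc N)
  disjoint l (d , >d , lg , _ , refl) = ℕ.<-irrefl refl
    (ℕ.≤-trans (ℕ.≤-reflexive (sym (smallest-++-replicate k (suc N) >d lg))) (proj₂ (∈-sptdoUpTo⁻ k N l)))

Sptdo⇒∈-sptdoUpTo : ∀ k {n π} → Sptdo (suc k) n π → π ∈ sptdoUpTo (suc k) n n
Sptdo⇒∈-sptdoUpTo k {n} {π} (sptdoPartition (isPartition ≥π pos sum≡) mult dist par) =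
  subst (_∈ sptdoUpTo (suc k) n n) (sym π≡)
    (subst (λ x → d ++ replicate (suc k) s ∈ sptdoUpTo (suc k) n x) (sym n≡)
      -- The smallest part is itself a part, hence at most `n`, so the cutoff `N = n` loses nothing.
      (∈-sptdoUpTo⁺ (suc k) (All.lookup pos s∈) (subst (s ≤_) sum≡ (∈⇒≤sum s∈)) d∈))
  where
  s = smallest π
  d = remaining π
  ≥-pairs : AllPairs _≥_ π
  ≥-pairs = Linked⇒AllPairs (λ a b → ℕ.≤-trans b a) ≥π
  π≡ : π ≡ d ++ replicate (suc k) s
  π≡ = trans (nonincreasing-split s ≥-pairs (smallest-≤ π)) (cong (λ j → d ++ replicate j s) mult)
  s∈ : s ∈ π
  s∈ = subst (s ∈_) (sym π≡) (∈-++⁺ʳ d (here refl))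
  n≡ : n ≡ suc k * s + sum d
  n≡ = trans (sym sum≡) (trans (cong sum π≡) (trans (sum-++ d (replicate (suc k) s))
    (trans (cong (ℕ._+_ (sum d)) (sum-replicate (suc k) s)) (ℕ.+-comm (sum d) (suc k * s)))))
  d∈ : d ∈ distinctPartitions s (suc (sum d)) (sum d)
  d∈ = Equivalence.from (∈-distinctPartitions s (sum d))
    -- Nonincreasing and pairwise distinct together mean strictly decreasing.
    ( AllPairs.zipWith (λ (a , b) → ℕ.≤∧≢⇒< a (b ∘ sym)) (AllPairs.filter⁺ (s ℕ.<?_) ≥-pairs , dist)
    , All.zip (All.all-filter (s ℕ.<?_) π , par)
    , refl )

-- Two duplicate-free lists with the same members are permutations of each other and so have equal
-- length.
sptdo-F : ∀ k n → + sptdo (suc k) n ≡ F (suc k) n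
sptdo-F k n = trans
  (cong +_ (↭-length (∼bag⇒↭ (unique∧set⇒bag (Sptdo-list-unique (suc k) n) (sptdoUpTo-unique k n n) same))))
  (length-sptdoUpTo (suc k) n n)
  where
  same : ∀ {π} → π ∈ Sptdo-list (suc k) n ⇔ π ∈ sptdoUpTo (suc k) n n
  same {π} = mk⇔
    (Sptdo⇒∈-sptdoUpTo k ∘ Equivalence.to (∈-Sptdo-list (suc k) n π))
    (Equivalence.from (∈-Sptdo-list (suc k) n π) ∘ proj₁ ∘ ∈-sptdoUpTo⁻ k n)

theorem3 : (k : ℕ) → 1 ≤ k →
    sptdoSeries k ≈
    V k ⊛ poch∞ (⊝ (q ^ 2)) (q ^ 2)
    ⊕ W k ⊛ poch∞ (⊝ q) (q ^ 2)
    ⊕ const (+ 2) ⊛ (⊝ q) ^ k ⊛ poch (q ^ 2) (q ^ 2) (k ∸ 1)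
theorem3 (suc k) _ n = trans (coefficient n) (F-closed k n)
  where
  coefficient : ∀ n → sptdoSeries (suc k) n ≡ F (suc k) n
  -- The series starts at n = 1, and `F (suc k) 0` is an empty sum.
  coefficient zero    = refl
  coefficient (suc n) = sptdo-F k (suc n)
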